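{- The cut rule $$\frac{\Gamma\Rightarrow\Delta,i:\phi\qquad i:\phi,\Gamma\Rightarrow\Delta}{\Gamma\Rightarrow\Delta}$$ is admissible in $\mathbf{DS}$ and in $\mathbf{DS}^{\mathbf{cc}}$; that is, for each of the two systems, whenever both premises are provable in the system, so is the conclusion.
   Context: Language. Fix a countable set $\mathrm{At}$ of propositional variables and a countably infinite set $N$ of nominals. PNL formulas: $\phi ::= p \mid R^+(i,j)\mid R^-(i,j)\mid \neg\phi\mid\phi\wedge\phi\mid\phi\vee\phi\mid\Diamond^+\phi\mid\Diamond^-\phi\mid[A]\phi$ with $p\in\mathrm{At}$, $i,j\in N$. Formulas $p$, $R^\pm(i,j)$ are elementary; $\pm$ stands for either $+$ or $-$. Sequents. A labeled nominal formula is $i:\phi$ ($i$ a nominal, $\phi$ a PNL formula) or a relational atom $R^\pm(i,j)$; $k:R^\pm(i,j)$ is identified with $R^\pm(i,j)$. A labeled sequent $\Gamma\Rightarrow\Delta$ consists of finite multisets $\Gamma,\Delta$ of labeled nominal formulas. System $\mathbf{DS}$ (premises / conclusion; $\Gamma,\Delta$ arbitrary): - (init) no premise / $\Gamma,i:\phi_{el}\Rightarrow\Delta,i:\phi_{el}$, with $\phi_{el}$ elementary. - $(L_c)$ $\Gamma,i:\phi,i:\phi\Rightarrow\Delta$ / $\Gamma,i:\phi\Rightarrow\Delta$; $(R_c)$ $\Gamma\Rightarrow i:\phi,i:\phi,\Delta$ / $\Gamma\Rightarrow i:\phi,\Delta$. - $(L_\neg)$ $\Gamma\Rightarrow i:\phi,\Delta$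 / $\Gamma,i:\neg\phi\Rightarrow\Delta$; $(R_\neg)$ $\Gamma,i:\phi\Rightarrow\Delta$ / $\Gamma\Rightarrow i:\neg\phi,\Delta$. - $(L_\vee)$ $\Gamma,i:\phi\Rightarrow\Delta$ and $\Gamma,i:\psi\Rightarrow\Delta$ / $\Gamma,i:\phi\vee\psi\Rightarrow\Delta$; $(R_\vee^1)$ $\Gamma\Rightarrow i:\phi,\Delta$ / $\Gamma\Rightarrow i:\phi\vee\psi,\Delta$; $(R_\vee^2)$ $\Gamma\Rightarrow i:\psi,\Delta$ / $\Gamma\Rightarrow i:\phi\vee\psi,\Delta$. - $(L_\wedge^1)$ $\Gamma,i:\phi\Rightarrow\Delta$ / $\Gamma,i:\phi\wedge\psi\Rightarrow\Delta$; $(L_\wedge^2)$ $\Gamma,i:\psi\Rightarrow\Delta$ / $\Gamma,i:\phi\wedge\psi\Rightarrow\Delta$; $(R_\wedge)$ $\Gamma\Rightarrow i:\phi,\Delta$ and $\Gamma\Rightarrow i:\psi,\Delta$ / $\Gamma\Rightarrow i:\phi\wedge\psi,\Delta$. - $(L_{\Diamond^\pm})_1$ $\Gamma,R^\pm(i,j)\Rightarrow\Delta$ / $\Gamma,i:\Diamond^\pm\phi\Rightarrow\Delta$, $j$ fresh (not occurring in the conclusion); $(L_{\Diamond^\pm})_2$ $\Gamma,j:\phi\Rightarrow\Delta$ / $\Gamma,i:\Diamond^\pm\phi\Rightarrow\Delta$, $j$ fresh; $(R_{\Diamond^\pm})$ $\Gamma\Rightarrow R^\pm(i,j),\Delta$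 and $\Gamma\Rightarrow j:\phi,\Delta$ / $\Gamma\Rightarrow i:\Diamond^\pm\phi,\Delta$, where for $\Diamond^-$ it is required that $i\neq j$. - $(L_{[A]})$ $\Gamma,j:\phi\Rightarrow\Delta$ / $\Gamma,i:[A]\phi\Rightarrow\Delta$; $(R_{[A]})$ $\Gamma\Rightarrow j:\phi,\Delta$ / $\Gamma\Rightarrow i:[A]\phi,\Delta$, $j$ fresh. - (sym) $\Gamma\Rightarrow\Delta,R^\pm(j,i)$ / $\Gamma\Rightarrow\Delta,R^\pm(i,j)$; (ref+) no premise / $\Gamma\Rightarrow\Delta,R^+(i,i)$; (ref−) no premise / $\Gamma,R^-(i,i)\Rightarrow\Delta$; (no) $\Gamma\Rightarrow\Delta,R^+(i,j)$ and $\Gamma\Rightarrow\Delta,R^-(i,j)$ / $\Gamma\Rightarrow\Delta$. $\mathbf{DS}^{\mathbf{cc}}$ is $\mathbf{DS}$ plus (cc): no premise / $\Gamma\Rightarrow\Delta,R^+(i,j),R^-(i,j)$. -}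

module Defs where

open import Data.Empty using (⊥)
open import Data.List.Base using (List; []; _∷_; _++_; concatMap)
open import Data.List.Membership.Propositional using (_∉_)
open import Data.List.Relation.Binary.Permutation.Propositional using (_↭_)
open import Data.Sign.Base using (Sign; +; -)
open import Data.Unit.Base using (⊤)
open import Relation.Binary.PropositionalEquality using (_≡_; _≢_)

data System : Set where
  DS DSᶜᶜ : System

module PNL (At N : Set) where

  infix  9 ~_ [A]_
  infixr 8 _∧_
  infixr 7 _∨_
  infix  6 _∶_

  data Formula : Set where
    var     : At → Formula
    R       : Sign → N → N → Formula
    ~_      : Formula → Formula
    _∧_ _∨_ : Formula → Formula → Formula
    ◇       : Sign → Formula → Formula
    [A]_    : Formula → Formula

  data Elementary : Formula → Set where
    var : ∀ p → Elementary (var p)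
    R   : ∀ s i j → Elementary (R s i j)

  NonRelational : Formula → Set
  NonRelational (R _ _ _) = ⊥
  NonRelational _         = ⊤

  -- The identification of k : R±(i,j) with the relational atom R±(i,j) is
  -- built in: relational atoms carry no label, and only the other formulas
  -- can be labeled by the constructor lab.
  data LFormula : Set where
    lab : (i : N) (φ : Formula) → .(NonRelational φ) → LFormula
    rel : Sign → N → N → LFormula

  _∶_ : N → Formula → LFormula
  i ∶ var p     = lab i (var p) _
  i ∶ R s j k   = rel s j k
  i ∶ (~ φ)     = lab i (~ φ) _
  i ∶ (φ ∧ ψ)   = lab i (φ ∧ ψ) _
  i ∶ (φ ∨ ψ)   = lab i (φ ∨ ψ) _
  i ∶ ◇ s φ     = lab i (◇ s φ) _
  i ∶ ([A] φ)   = lab i ([A] φ) _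

  nominals : Formula → List N
  nominals (var p)   = []
  nominals (R s i j) = i ∷ j ∷ []
  nominals (~ φ)     = nominals φ
  nominals (φ ∧ ψ)   = nominals φ ++ nominals ψ
  nominals (φ ∨ ψ)   = nominals φ ++ nominals ψ
  nominals (◇ s φ)   = nominals φ
  nominals ([A] φ)   = nominals φ

  nominalsᴸ : LFormula → List N
  nominalsᴸ (lab i φ _) = i ∷ nominals φ
  nominalsᴸ (rel s i j) = i ∷ j ∷ []

  Context : Set
  Context = List LFormula

  Fresh : N → Context → Context → Set
  Fresh j Γ Δ = j ∉ concatMap nominalsᴸ (Γ ++ Δ)

  private variable
    Γ Γ′ Δ Δ′ : Context
    φ ψ       : Formula
    i j       : N
    s         : Sign

  infix 4 _⊢_⇒_

  -- Finite multisets are lists up to permutation; exch makes provability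
  -- depend only on the underlying multisets, so the formulas a rule acts on
  -- can be placed at the head of the lists.
  data _⊢_⇒_ (S : System) : Context → Context → Set where
    exch : Γ ↭ Γ′ → Δ ↭ Δ′ → S ⊢ Γ ⇒ Δ → S ⊢ Γ′ ⇒ Δ′

    init : Elementary φ → S ⊢ i ∶ φ ∷ Γ ⇒ i ∶ φ ∷ Δ

    Lc : S ⊢ i ∶ φ ∷ i ∶ φ ∷ Γ ⇒ Δ → S ⊢ i ∶ φ ∷ Γ ⇒ Δ
    Rc : S ⊢ Γ ⇒ i ∶ φ ∷ i ∶ φ ∷ Δ → S ⊢ Γ ⇒ i ∶ φ ∷ Δ

    L¬ : S ⊢ Γ ⇒ i ∶ φ ∷ Δ → S ⊢ i ∶ (~ φ) ∷ Γ ⇒ Δ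
    R¬ : S ⊢ i ∶ φ ∷ Γ ⇒ Δ → S ⊢ Γ ⇒ i ∶ (~ φ) ∷ Δ

    L∨  : S ⊢ i ∶ φ ∷ Γ ⇒ Δ → S ⊢ i ∶ ψ ∷ Γ ⇒ Δ → S ⊢ i ∶ (φ ∨ ψ) ∷ Γ ⇒ Δ
    R∨₁ : S ⊢ Γ ⇒ i ∶ φ ∷ Δ → S ⊢ Γ ⇒ i ∶ (φ ∨ ψ) ∷ Δ
    R∨₂ : S ⊢ Γ ⇒ i ∶ ψ ∷ Δ → S ⊢ Γ ⇒ i ∶ (φ ∨ ψ) ∷ Δ

    L∧₁ : S ⊢ i ∶ φ ∷ Γ ⇒ Δ → S ⊢ i ∶ (φ ∧ ψ) ∷ Γ ⇒ Δ
    L∧₂ : S ⊢ i ∶ ψ ∷ Γ ⇒ Δ → S ⊢ i ∶ (φ ∧ ψ) ∷ Γ ⇒ Δ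
    R∧  : S ⊢ Γ ⇒ i ∶ φ ∷ Δ → S ⊢ Γ ⇒ i ∶ ψ ∷ Δ → S ⊢ Γ ⇒ i ∶ (φ ∧ ψ) ∷ Δ

    L◇₁ : Fresh j (i ∶ ◇ s φ ∷ Γ) Δ →
          S ⊢ rel s i j ∷ Γ ⇒ Δ → S ⊢ i ∶ ◇ s φ ∷ Γ ⇒ Δ
    L◇₂ : Fresh j (i ∶ ◇ s φ ∷ Γ) Δ →
          S ⊢ j ∶ φ ∷ Γ ⇒ Δ → S ⊢ i ∶ ◇ s φ ∷ Γ ⇒ Δ
    R◇  : (s ≡ - → i ≢ j) →
          S ⊢ Γ ⇒ rel s i j ∷ Δ → S ⊢ Γ ⇒ j ∶ φ ∷ Δ → S ⊢ Γ ⇒ i ∶ ◇ s φ ∷ Δ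

    L[A] : S ⊢ j ∶ φ ∷ Γ ⇒ Δ → S ⊢ i ∶ ([A] φ) ∷ Γ ⇒ Δ
    R[A] : Fresh j Γ (i ∶ ([A] φ) ∷ Δ) →
           S ⊢ Γ ⇒ j ∶ φ ∷ Δ → S ⊢ Γ ⇒ i ∶ ([A] φ) ∷ Δ

    sym  : S ⊢ Γ ⇒ rel s j i ∷ Δ → S ⊢ Γ ⇒ rel s i j ∷ Δ
    ref+ : S ⊢ Γ ⇒ rel + i i ∷ Δ
    ref- : S ⊢ rel - i i ∷ Γ ⇒ Δ
    no   : S ⊢ Γ ⇒ rel + i j ∷ Δ → S ⊢ Γ ⇒ rel - i j ∷ Δ → S ⊢ Γ ⇒ Δ

    cc   : S ≡ DSᶜᶜ → S ⊢ Γ ⇒ rel + i j ∷ rel - i j ∷ Δ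

  CutAdmissible : System → Set
  CutAdmissible S = ∀ {Γ Δ i φ} →
    S ⊢ Γ ⇒ i ∶ φ ∷ Δ → S ⊢ i ∶ φ ∷ Γ ⇒ Δ → S ⊢ Γ ⇒ Δ

{-# OPTIONS --safe #-}

-- Cut is eliminated in an auxiliary infinitary calculus ⊩ and transferred back.
-- In ⊩ principal formulas are never consumed, so weakening and contraction are
-- immediate, and the rules with an eigenvariable j have one premise for every
-- nominal j, so that the principal reductions for ◇ and [A] need no
-- substitution.  A DS derivation yields, for each renaming of nominals, an
-- ⊩ derivation of the renamed sequent; conversely, an ⊩ derivation is turned
-- into a DS derivation by picking the premise of a fresh nominal.  A renaming
-- can violate the side condition i ≠ j of (R◇⁻), but then its premise
-- R⁻(i,i) and R⁺(i,i) give the conclusion by (no).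

module Submission where

open import Data.Bool.Base using (Bool; true; false; if_then_else_)
open import Data.Empty using (⊥; ⊥-elim)
open import Data.List.Base using (List; []; _∷_; [_]; _++_; concatMap; map)
open import Data.List.Membership.Propositional using (_∈_; _∉_)
open import Data.List.Membership.Propositional.Properties
  using (∈-++⁺ˡ; ∈-++⁺ʳ; ∈-++⁻; ∈-map⁺; ∈-∃++)
open import Data.List.Relation.Binary.Permutation.Propositional
  using (_↭_; ↭-refl; ↭-sym; prep)
open import Data.List.Relation.Binary.Permutation.Propositional.Properties
  using (All-resp-↭; shift)
open import Data.List.Relation.Binary.Subset.Propositional using (_⊆_)
open import Data.List.Relation.Binary.Subset.Propositional.Properties
  using (++⁺ʳ; ∷⁺ʳ; ∈-∷⁺ʳ; ⊆-refl; ⊆-trans; xs⊆ys++xs)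
open import Data.List.Relation.Unary.All as All using (All; []; _∷_)
import Data.List.Relation.Unary.All.Properties as All
open import Data.List.Relation.Unary.Any using (here; there)
open import Data.Nat.Base using (ℕ; suc; _<_; _⊔_)
open import Data.Nat.Properties
  using (<-irrefl; n<1+n; m<n⇒m<n⊔o; m<n⇒m<o⊔n) renaming (_≟_ to _≟ℕ_)
open import Data.Product.Base using (_×_; _,_; ∃; ∃₂)
open import Data.Sign.Base using (Sign; +; -)
open import Data.Sum.Base using (_⊎_; inj₁; inj₂)
open import Data.Unit.Base using (⊤; tt)
open import Function.Base using (_∘_; id)
open import Function.Bundles using (_↣_; _↔_; Inverse)
open import Function.Properties.Inverse using (↔⇒↣)
open import Level using (Lift)
open import Relation.Binary.Definitions using (DecidableEquality)
open import Relation.Binary.PropositionalEquality as ≡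
  using (_≡_; _≢_; refl; cong; cong₂; subst)
open import Relation.Nullary using (Dec; yes) renaming (no to no′)
open import Relation.Nullary.Decidable using (via-injection)

open import Defs

-- Inclusions between lists with a distinguished entry.

∈-∷-split : ∀ {A : Set} {x : A} {xs ys} → xs ⊆ x ∷ ys → xs ⊆ ys ⊎ x ∈ xs
∈-∷-split {xs = []} inc = inj₁ λ ()
∈-∷-split {xs = y ∷ xs} inc with inc (here refl) | ∈-∷-split (inc ∘ there)
-- The inclusion proof itself sorts the entries: one that it sends to the head is `x`, and if none
-- is, all of them lie in `ys`.
... | here refl | _         = inj₂ (here refl)
... | there _   | inj₂ x∈xs = inj₂ (there x∈xs)
... | there y∈  | inj₁ xs⊆  = inj₁ (∈-∷⁺ʳ y∈ xs⊆)

++-∷-⊆ : ∀ {A : Set} {x : A} {xs ys} zs → xs ⊆ x ∷ ys → zs ++ xs ⊆ x ∷ zs ++ ys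
++-∷-⊆ zs inc p with ∈-++⁻ zs p
... | inj₁ q = there (∈-++⁺ˡ q)
... | inj₂ q with inc q
...   | here e  = here e
...   | there r = there (∈-++⁺ʳ zs r)

-- The infinitary calculus, its structural rules and the commutation of cuts.

module Infinitary (At N : Set) (S : System) where
  open PNL At N

  infix 7 _ˡ _ʳ
  infix 4 ⊩_

  -- Both sides of a sequent are kept in one list, with `ˡ` marking the antecedent and `ʳ` the
  -- succedent, so that a single inclusion handles both.
  data Signed : Set where
    _ˡ _ʳ : LFormula → Signed

  Sequent : Set
  Sequent = List Signed

  private variable
    φ ψ   : Formula
    i j   : N
    s     : Sign
    a     : LFormula
    x     : Signed
    I     : Set
    Γ Δ Π : Sequent
    P Q   : I → Sequent

  only : Signed → ⊤ → Sequent
  only x _ = [ x ]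

  either : Signed → Signed → Bool → Sequent
  either x y b = [ if b then x else y ]

  none : ⊥ → Sequent
  none ()

  -- `I` indexes the premises: `⊤`, `Bool`, or `N` for the eigenvariable rules. The family gives
  -- only the formulas that a premise adds to the conclusion.
  data Logical : Signed → (I → Sequent) → Set₁ where
    L¬   : Logical ((i ∶ (~ φ)) ˡ) (only ((i ∶ φ) ʳ))
    R¬   : Logical ((i ∶ (~ φ)) ʳ) (only ((i ∶ φ) ˡ))
    L∨   : Logical ((i ∶ (φ ∨ ψ)) ˡ) (either ((i ∶ φ) ˡ) ((i ∶ ψ) ˡ))
    R∨₁  : Logical ((i ∶ (φ ∨ ψ)) ʳ) (only ((i ∶ φ) ʳ))
    R∨₂  : Logical ((i ∶ (φ ∨ ψ)) ʳ) (only ((i ∶ ψ) ʳ))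
    L∧₁  : Logical ((i ∶ (φ ∧ ψ)) ˡ) (only ((i ∶ φ) ˡ))
    L∧₂  : Logical ((i ∶ (φ ∧ ψ)) ˡ) (only ((i ∶ ψ) ˡ))
    R∧   : Logical ((i ∶ (φ ∧ ψ)) ʳ) (either ((i ∶ φ) ʳ) ((i ∶ ψ) ʳ))
    L◇₁  : Logical ((i ∶ ◇ s φ) ˡ) (λ j → [ rel s i j ˡ ])
    L◇₂  : Logical ((i ∶ ◇ s φ) ˡ) (λ j → [ (j ∶ φ) ˡ ])
    R◇   : (s ≡ - → i ≢ j) →
           Logical ((i ∶ ◇ s φ) ʳ) (either (rel s i j ʳ) ((j ∶ φ) ʳ))
    L[A] : Logical ((i ∶ ([A] φ)) ˡ) (only ((j ∶ φ) ˡ))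
    R[A] : Logical ((i ∶ ([A] φ)) ʳ) (λ j → [ (j ∶ φ) ʳ ])

  data Rule : Sequent → (I → Sequent) → Set₁ where
    logical : Logical x P → Rule [ x ] P
    init    : Elementary φ → Rule ((i ∶ φ) ˡ ∷ (i ∶ φ) ʳ ∷ []) none
    sym     : Rule [ rel s i j ʳ ] (only (rel s j i ʳ))
    ref+    : Rule [ rel + i i ʳ ] none
    ref-    : Rule [ rel - i i ˡ ] none
    no      : Rule [] (either (rel + i j ʳ) (rel - i j ʳ))
    cc      : S ≡ DSᶜᶜ → Rule (rel + i j ʳ ∷ rel - i j ʳ ∷ []) none

  data ⊩_ : Sequent → Set₁ where
    infer : {P : I → Sequent} →
            Rule Π P → Π ⊆ Γ → (∀ p → ⊩ P p ++ Γ) → ⊩ Γ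

  weaken : Γ ⊆ Δ → ⊩ Γ → ⊩ Δ
  weaken inc (infer {P = P} r Π⊆ ds) =
    infer r (⊆-trans Π⊆ inc) λ p → weaken (++⁺ʳ (P p) inc) (ds p)

  contract : x ∈ Γ → ⊩ x ∷ Γ → ⊩ Γ
  contract x∈Γ = weaken (∈-∷⁺ʳ x∈Γ ⊆-refl)

  pair : ∀ {x y} → ⊩ x ∷ Γ → ⊩ y ∷ Γ → ∀ b → ⊩ either x y b ++ Γ
  pair d e true  = d
  pair d e false = e

  -- This does the work of a cut against `ref-`: rule `no` pairs the given premise with an instance
  -- of `ref+`.
  irreflexive : ⊩ rel - i i ʳ ∷ Γ → ⊩ Γ
  irreflexive d = infer no (λ ()) (pair (infer ref+ (λ { (here refl) → here refl }) λ ()) d)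

  -- The commutation steps of cut elimination, with x the cut formula on one
  -- side and K standing for what is known about the other premise of the cut.
  absorb : (K : Sequent → Set₁) → (∀ {Γ Δ} → Γ ⊆ Δ → K Γ → K Δ) →
           (∀ {I Π} {P : I → Sequent} {Γ} → K Γ → Rule Π P → x ∈ Π → Π ⊆ x ∷ Γ →
              (∀ p → ⊩ P p ++ Γ) → ⊩ Γ) →
           K Γ → Δ ⊆ x ∷ Γ → ⊩ Δ → ⊩ Γ
  absorb {x = x} {Γ = Γ} K mono principal k inc (infer {Π = Π} {P = P} r Π⊆ ds) =
    case (∈-∷-split (⊆-trans Π⊆ inc))
    where
    ds′ : ∀ p → ⊩ P p ++ Γ
    -- The formulas added by a premise join the context, so `K` is weakened along them and the
    -- recursion descends to a subderivation.
    ds′ p = absorb K mono principal (mono (xs⊆ys++xs Γ (P p)) k) (++-∷-⊆ (P p) inc) (ds p)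

    case : Π ⊆ Γ ⊎ x ∈ Π → ⊩ Γ
    case (inj₁ Π⊆Γ) = infer r Π⊆Γ ds′
    case (inj₂ x∈Π) = principal k r x∈Π (⊆-trans Π⊆ inc) ds′

  -- Principal reductions and cut elimination.

  Cut : LFormula → Set₁
  Cut a = ∀ {Γ} → ⊩ a ʳ ∷ Γ → ⊩ a ˡ ∷ Γ → ⊩ Γ

  -- The induction hypothesis on the cut formula. Under `◇` and `[A]` it covers every nominal `j`,
  -- because the opposing rule chooses the label; `◇` also calls for cuts on relational atoms.
  ComponentCuts : LFormula → Set₁
  ComponentCuts (lab i (~ φ) _)   = Cut (i ∶ φ)
  ComponentCuts (lab i (φ ∧ ψ) _) = Cut (i ∶ φ) × Cut (i ∶ ψ)
  ComponentCuts (lab i (φ ∨ ψ) _) = Cut (i ∶ φ) × Cut (i ∶ ψ)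
  ComponentCuts (lab i (◇ s φ) _) = (∀ j → Cut (rel s i j)) × (∀ j → Cut (j ∶ φ))
  ComponentCuts (lab i ([A] φ) _) = ∀ j → Cut (j ∶ φ)
  ComponentCuts _                 = Lift _ ⊤

  -- One smaller cut suffices in each case. The nominal chosen by `R◇` or `L[A]` selects the premise
  -- of the opposing rule, and each of the two left rules for `◇` meets just one premise of `R◇`.
  reduce : ComponentCuts a → Logical (a ˡ) P → Logical (a ʳ) Q →
           (∀ p → ⊩ P p ++ Γ) → (∀ q → ⊩ Q q ++ Γ) → ⊩ Γ
  reduce cut         L¬   R¬             ds es = cut (ds tt) (es tt)
  reduce (cut , _)   L∨   R∨₁            ds es = cut (es tt) (ds true)
  reduce (_ , cut)   L∨   R∨₂            ds es = cut (es tt) (ds false)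
  reduce (cut , _)   L∧₁  R∧             ds es = cut (es true) (ds tt)
  reduce (_ , cut)   L∧₂  R∧             ds es = cut (es false) (ds tt)
  reduce (cut , _)   L◇₁  (R◇ {j = j} _) ds es = cut j (es true) (ds j)
  reduce (_ , cut)   L◇₂  (R◇ {j = j} _) ds es = cut j (es false) (ds j)
  reduce cut (L[A] {j = j}) R[A]         ds es = cut j (es j) (ds tt)

  elementary-not-logical : Elementary φ → Logical ((i ∶ φ) ˡ) P → ⊥
  elementary-not-logical (var _)   ()
  elementary-not-logical (R _ _ _) ()

  -- The inner induction: the last rule on the left is fixed as `l`, its premises already freed of
  -- the cut formula, and the derivation of `a ʳ ∷ Γ` is traversed until `a ʳ` is principal. The
  -- other rules with a principal formula on the right have an elementary one there, which no
  -- logical rule introduces.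
  cut-logical : ComponentCuts a → Logical (a ˡ) P →
                (∀ p → ⊩ P p ++ Γ) → ⊩ a ʳ ∷ Γ → ⊩ Γ
  cut-logical {a = a} {P = P} cuts l ds =
    absorb (λ Γ → ∀ p → ⊩ P p ++ Γ) (λ inc ds p → weaken (++⁺ʳ (P p) inc) (ds p))
      principal ds ⊆-refl
    where
    principal : ∀ {I Π} {Q : I → Sequent} {Γ} → (∀ p → ⊩ P p ++ Γ) → Rule Π Q →
                a ʳ ∈ Π → Π ⊆ a ʳ ∷ Γ → (∀ q → ⊩ Q q ++ Γ) → ⊩ Γ
    principal ds (logical r)        (here refl)         _ es = reduce cuts l r ds es
    principal _  (init e)    (there (here refl)) = ⊥-elim (elementary-not-logical e l)
    principal _  (sym {i = i})  (here refl)         = ⊥-elim (elementary-not-logical {i = i} (R _ _ _) l)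
    principal _  (ref+ {i = i}) (here refl)         = ⊥-elim (elementary-not-logical {i = i} (R _ _ _) l)
    principal _  (cc {i = i} _) (here refl)         = ⊥-elim (elementary-not-logical {i = i} (R _ _ _) l)
    principal _  (cc {i = i} _) (there (here refl)) = ⊥-elim (elementary-not-logical {i = i} (R _ _ _) l)
    principal ds (init _)           (here ())
    principal ds ref-               (here ())
    principal ds no                 ()

  -- The outer induction is on the derivation containing `a ˡ`. On that side an elementary formula
  -- is principal only in `init` and `ref-`, so `sym`, `ref+` and `cc` never face a reduction of
  -- their own.
  cut-step : ∀ a → ComponentCuts a → Cut a
  cut-step a cuts d =
    absorb (λ Γ → ⊩ a ʳ ∷ Γ) (λ inc → weaken (∷⁺ʳ _ inc)) principal d ⊆-refl
    where
    principal : ∀ {I Π} {P : I → Sequent} {Γ} → ⊩ a ʳ ∷ Γ → Rule Π P →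
                a ˡ ∈ Π → Π ⊆ a ˡ ∷ Γ → (∀ p → ⊩ P p ++ Γ) → ⊩ Γ
    principal d (logical l) (here refl) _ ds = cut-logical cuts l ds d
    -- The second principal formula of `init` is `a ʳ`; its side differs from that of `a ˡ`, so it
    -- lies in `Γ` and the other premise contracts.
    principal d (init _) (here refl) inc _ with inc (there (here refl))
    ... | there aʳ∈Γ = contract aʳ∈Γ d
    principal d ref- (here refl) _ _ = irreflexive d
    principal d (init _) (there (here ()))
    principal d sym      (here ())
    principal d ref+     (here ())
    principal d no       ()
    principal d (cc _)   (here ())
    principal d (cc _)   (there (here ()))

  cut : ∀ i φ → Cut (i ∶ φ)
  cut i (var p)   = cut-step (i ∶ var p) _
  cut i (R s j k) = cut-step (rel s j k) _
  cut i (~ φ)     = cut-step (i ∶ (~ φ)) (cut i φ)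
  cut i (φ ∧ ψ)   = cut-step (i ∶ (φ ∧ ψ)) (cut i φ , cut i ψ)
  cut i (φ ∨ ψ)   = cut-step (i ∶ (φ ∨ ψ)) (cut i φ , cut i ψ)
  cut i (◇ s φ)   = cut-step (i ∶ ◇ s φ) ((λ j → cut-step (rel s i j) _) , λ j → cut j φ)
  cut i ([A] φ)   = cut-step (i ∶ ([A] φ)) λ j → cut j φ

-- Renaming of nominals.

module Renaming (At N : Set) (_≟_ : DecidableEquality N) where
  open PNL At N

  rename : (N → N) → Formula → Formula
  rename σ (var p)   = var p
  rename σ (R s i j) = R s (σ i) (σ j)
  rename σ (~ φ)     = ~ rename σ φ
  rename σ (φ ∧ ψ)   = rename σ φ ∧ rename σ ψ
  rename σ (φ ∨ ψ)   = rename σ φ ∨ rename σ ψ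
  rename σ (◇ s φ)   = ◇ s (rename σ φ)
  rename σ ([A] φ)   = [A] rename σ φ

  renameᴸ : (N → N) → LFormula → LFormula
  renameᴸ σ (lab i φ _) = σ i ∶ rename σ φ
  renameᴸ σ (rel s i j) = rel s (σ i) (σ j)

  renameᴸ-∶ : ∀ σ i φ → renameᴸ σ (i ∶ φ) ≡ σ i ∶ rename σ φ
  renameᴸ-∶ σ i (var p)   = refl
  renameᴸ-∶ σ i (R s j k) = refl
  renameᴸ-∶ σ i (~ φ)     = refl
  renameᴸ-∶ σ i (φ ∧ ψ)   = refl
  renameᴸ-∶ σ i (φ ∨ ψ)   = refl
  renameᴸ-∶ σ i (◇ s φ)   = refl
  renameᴸ-∶ σ i ([A] φ)   = refl

  rename-elementary : ∀ σ {φ} → Elementary φ → Elementary (rename σ φ)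
  rename-elementary σ (var p)   = var p
  rename-elementary σ (R s i j) = R s (σ i) (σ j)

  rename-id : ∀ φ → rename id φ ≡ φ
  rename-id (var p)   = refl
  rename-id (R s i j) = refl
  rename-id (~ φ)     = cong ~_ (rename-id φ)
  rename-id (φ ∧ ψ)   = cong₂ _∧_ (rename-id φ) (rename-id ψ)
  rename-id (φ ∨ ψ)   = cong₂ _∨_ (rename-id φ) (rename-id ψ)
  rename-id (◇ s φ)   = cong (◇ s) (rename-id φ)
  rename-id ([A] φ)   = cong [A]_ (rename-id φ)

  -- The contraction rules are stated for `i ∶ φ`; this makes them available for every labeled
  -- formula. A relational atom ignores its label, so its first nominal serves as one.
  ∶-surjective : ∀ a → ∃₂ λ i φ → i ∶ φ ≡ a
  ∶-surjective (lab i (var p) _)   = i , var p , refl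
  ∶-surjective (lab i (R _ _ _) ())
  ∶-surjective (lab i (~ φ) _)     = i , (~ φ) , refl
  ∶-surjective (lab i (φ ∧ ψ) _)   = i , φ ∧ ψ , refl
  ∶-surjective (lab i (φ ∨ ψ) _)   = i , φ ∨ ψ , refl
  ∶-surjective (lab i (◇ s φ) _)   = i , ◇ s φ , refl
  ∶-surjective (lab i ([A] φ) _)   = i , ([A] φ) , refl
  ∶-surjective (rel s i j)         = i , R s i j , refl

  renameᴸ-id : ∀ a → renameᴸ id a ≡ a
  renameᴸ-id a with ∶-surjective a
  ... | i , φ , refl = ≡.trans (renameᴸ-∶ id i φ) (cong (i ∶_) (rename-id φ))

  _[_≔_] : (N → N) → N → N → N → N
  (σ [ j ≔ k ]) i with i ≟ j
  ... | yes _ = k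
  ... | no′ _ = σ i

  ≔-hit : ∀ σ j k → (σ [ j ≔ k ]) j ≡ k
  ≔-hit σ j k with j ≟ j
  ... | yes _   = refl
  ... | no′ j≢j = ⊥-elim (j≢j refl)

  ≔-miss : ∀ σ {i j} k → j ≢ i → (σ [ j ≔ k ]) i ≡ σ i
  ≔-miss σ {i} {j} k j≢i with i ≟ j
  ... | yes i≡j = ⊥-elim (j≢i (≡.sym i≡j))
  ... | no′ _   = refl

  rename-fresh : ∀ σ {j} k φ → j ∉ nominals φ → rename (σ [ j ≔ k ]) φ ≡ rename σ φ
  rename-fresh σ k (var p)   j∉ = refl
  rename-fresh σ k (R s i l) j∉ =
    cong₂ (R s) (≔-miss σ k (j∉ ∘ here)) (≔-miss σ k (j∉ ∘ there ∘ here))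
  rename-fresh σ k (~ φ)     j∉ = cong ~_ (rename-fresh σ k φ j∉)
  rename-fresh σ k (φ ∧ ψ)   j∉ =
    cong₂ _∧_ (rename-fresh σ k φ (j∉ ∘ ∈-++⁺ˡ))
              (rename-fresh σ k ψ (j∉ ∘ ∈-++⁺ʳ (nominals φ)))
  rename-fresh σ k (φ ∨ ψ)   j∉ =
    cong₂ _∨_ (rename-fresh σ k φ (j∉ ∘ ∈-++⁺ˡ))
              (rename-fresh σ k ψ (j∉ ∘ ∈-++⁺ʳ (nominals φ)))
  rename-fresh σ k (◇ s φ)   j∉ = cong (◇ s) (rename-fresh σ k φ j∉)
  rename-fresh σ k ([A] φ)   j∉ = cong [A]_ (rename-fresh σ k φ j∉)

  renameᴸ-fresh : ∀ σ {j} k a → j ∉ nominalsᴸ a → renameᴸ (σ [ j ≔ k ]) a ≡ renameᴸ σ a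
  renameᴸ-fresh σ k (lab i φ _) j∉ =
    cong₂ _∶_ (≔-miss σ k (j∉ ∘ here)) (rename-fresh σ k φ (j∉ ∘ there))
  renameᴸ-fresh σ k (rel s i l) j∉ =
    cong₂ (rel s) (≔-miss σ k (j∉ ∘ here)) (≔-miss σ k (j∉ ∘ there ∘ here))

  fresh-all : ∀ {j} Γ → j ∉ concatMap nominalsᴸ Γ → All (λ a → j ∉ nominalsᴸ a) Γ
  fresh-all []      j∉ = []
  fresh-all (a ∷ Γ) j∉ = j∉ ∘ ∈-++⁺ˡ ∷ fresh-all Γ (j∉ ∘ ∈-++⁺ʳ (nominalsᴸ a))

-- From finitary to infinitary derivations.

module Translation (At N : Set) (N↔ℕ : N ↔ ℕ) (S : System) where
  open PNL At N
  open Inverse N↔ℕ using (to; from; strictlyInverseˡ)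

  _≟_ : DecidableEquality N
  _≟_ = via-injection (↔⇒↣ N↔ℕ) _≟ℕ_

  open Renaming At N _≟_
  module I = Infinitary At N S
  open I using (Sequent; Signed; _ˡ; _ʳ; ⊩_; infer; logical; pair; cut)

  private variable
    Γ Δ : Context
    Σ   : Sequent
    j k : N
    σ   : N → N

  bound : (xs : List N) → ∃ λ m → All (λ i → to i < m) xs
  bound []       = 0 , []
  bound (i ∷ xs) with m , xs<m ← bound xs =
    suc (to i) ⊔ m ,
    m<n⇒m<n⊔o m (n<1+n (to i)) ∷ All.map (m<n⇒m<o⊔n (suc (to i))) xs<m

  -- The nominal whose code is a strict upper bound of all codes in `xs`.
  fresh : (xs : List N) → ∃ λ j → j ∉ xs
  fresh xs with m , xs<m ← bound xs =
    from m , λ j∈ → <-irrefl (strictlyInverseˡ m) (All.lookup xs<m j∈)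

  -- Membership in place of equality lets distinct formulas be identified by `σ` and makes order and
  -- multiplicity irrelevant.
  Lefts Rights : (N → N) → Context → Sequent → Set
  Lefts  σ Γ Σ = All (λ a → renameᴸ σ a ˡ ∈ Σ) Γ
  Rights σ Δ Σ = All (λ a → renameᴸ σ a ʳ ∈ Σ) Δ

  addˡ : ∀ {i φ x} → Lefts σ Γ Σ → x ≡ σ i ∶ rename σ φ → Lefts σ (i ∶ φ ∷ Γ) (x ˡ ∷ Σ)
  addˡ {i = i} {φ} ls refl = here (cong _ˡ (renameᴸ-∶ _ i φ)) ∷ All.map there ls

  addʳ : ∀ {i φ x} → Rights σ Δ Σ → x ≡ σ i ∶ rename σ φ → Rights σ (i ∶ φ ∷ Δ) (x ʳ ∷ Σ)
  addʳ {i = i} {φ} rs refl = here (cong _ʳ (renameᴸ-∶ _ i φ)) ∷ All.map there rs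

  -- The conclusion of an eigenvariable rule does not contain `j`, so redirecting `j` to `k` leaves
  -- its renamed formulas unchanged.
  refresh : (sign : LFormula → Signed) → All (λ a → j ∉ nominalsᴸ a) Γ →
            All (λ a → sign (renameᴸ σ a) ∈ Σ) Γ →
            All (λ a → sign (renameᴸ (σ [ j ≔ k ]) a) ∈ Σ) Γ
  refresh {Σ = Σ} sign fs as = All.zipWith
    (λ {a} (f , a∈) → subst (λ b → sign b ∈ Σ) (≡.sym (renameᴸ-fresh _ _ a f)) a∈)
    (fs , as)

  by : ∀ {I P} {x} → I.Logical {I} x P → x ∈ Σ → (∀ p → ⊩ P p ++ Σ) → ⊩ Σ
  by r x∈ = infer (logical r) λ { (here refl) → x∈ }

  -- The induction hypothesis holds for all `σ`, which turns the one premise of an eigenvariable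
  -- rule into a premise for each nominal `k`: it is interpreted with `j` sent to `k`. The rules
  -- `exch`, `Lc` and `Rc` only rearrange membership proofs.
  interpret : ∀ σ → S ⊢ Γ ⇒ Δ → Lefts σ Γ Σ → Rights σ Δ Σ → ⊩ Σ
  interpret σ (exch p q d) ls rs =
    interpret σ d (All-resp-↭ (↭-sym p) ls) (All-resp-↭ (↭-sym q) rs)
  interpret {Σ = Σ} σ (init {φ = φ} {i = i} e) (l ∷ ls) (r ∷ rs) =
    infer (I.init {i = σ i} (rename-elementary σ e))
      (λ { (here refl)         → subst (λ a → a ˡ ∈ Σ) (renameᴸ-∶ σ i φ) l
         ; (there (here refl)) → subst (λ a → a ʳ ∈ Σ) (renameᴸ-∶ σ i φ) r })
      λ ()
  interpret σ (Lc d) (l ∷ ls) rs = interpret σ d (l ∷ l ∷ ls) rs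
  interpret σ (Rc d) ls (r ∷ rs) = interpret σ d ls (r ∷ r ∷ rs)
  interpret σ (L¬ d) (l ∷ ls) rs =
    by I.L¬ l λ _ → interpret σ d (All.map there ls) (addʳ rs refl)
  interpret σ (R¬ d) ls (r ∷ rs) =
    by I.R¬ r λ _ → interpret σ d (addˡ ls refl) (All.map there rs)
  interpret σ (L∨ d e) (l ∷ ls) rs =
    by I.L∨ l (pair (interpret σ d (addˡ ls refl) (All.map there rs))
                    (interpret σ e (addˡ ls refl) (All.map there rs)))
  interpret σ (R∨₁ d) ls (r ∷ rs) =
    by I.R∨₁ r λ _ → interpret σ d (All.map there ls) (addʳ rs refl)
  interpret σ (R∨₂ d) ls (r ∷ rs) =
    by I.R∨₂ r λ _ → interpret σ d (All.map there ls) (addʳ rs refl)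
  interpret σ (L∧₁ d) (l ∷ ls) rs =
    by I.L∧₁ l λ _ → interpret σ d (addˡ ls refl) (All.map there rs)
  interpret σ (L∧₂ d) (l ∷ ls) rs =
    by I.L∧₂ l λ _ → interpret σ d (addˡ ls refl) (All.map there rs)
  interpret σ (R∧ d e) ls (r ∷ rs) =
    by I.R∧ r (pair (interpret σ d (All.map there ls) (addʳ rs refl))
                    (interpret σ e (All.map there ls) (addʳ rs refl)))
  interpret {Δ = Δ} σ (L◇₁ {j = j} {i = i} {s} {φ = φ} {Γ} j# d) (l ∷ ls) rs
    with f ∷ fs ← fresh-all (i ∶ ◇ s φ ∷ Γ ++ Δ) j# =
    by I.L◇₁ l λ k → interpret (σ [ j ≔ k ]) d
      (addˡ {i = i} {φ = R s i j} (refresh _ˡ (All.++⁻ˡ Γ fs) ls)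
        (cong₂ (rel s) (≡.sym (≔-miss σ k (f ∘ here))) (≡.sym (≔-hit σ j k))))
      (All.map there (refresh _ʳ (All.++⁻ʳ Γ fs) rs))
  interpret {Δ = Δ} σ (L◇₂ {j = j} {i = i} {s} {φ = φ} {Γ} j# d) (l ∷ ls) rs
    with f ∷ fs ← fresh-all (i ∶ ◇ s φ ∷ Γ ++ Δ) j# =
    by I.L◇₂ l λ k → interpret (σ [ j ≔ k ]) d
      (addˡ (refresh _ˡ (All.++⁻ˡ Γ fs) ls)
        (cong₂ _∶_ (≡.sym (≔-hit σ j k)) (≡.sym (rename-fresh σ k φ (f ∘ there)))))
      (All.map there (refresh _ʳ (All.++⁻ʳ Γ fs) rs))
  interpret {Σ = Σ} σ (R◇ {s = s} {i = i} {j = j} _ d e) ls (r ∷ rs) = choose s refl (σ i ≟ σ j)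
    where
    d′ : ⊩ rel s (σ i) (σ j) ʳ ∷ Σ
    d′ = interpret σ d (All.map there ls) (addʳ {i = i} {φ = R s i j} rs refl)

    conclude : (s ≡ - → σ i ≢ σ j) → ⊩ Σ
    conclude c = by (I.R◇ c) r (pair d′ (interpret σ e (All.map there ls) (addʳ rs refl)))

    choose : ∀ t → s ≡ t → Dec (σ i ≡ σ j) → ⊩ Σ
    choose + refl _         = conclude λ ()
    choose - refl (no′ i≢j)  = conclude λ _ → i≢j
    -- The relational premise alone gives the conclusion here.
    choose - refl (yes i≡j) =
      I.irreflexive (subst (λ k → ⊩ rel - (σ i) k ʳ ∷ Σ) (≡.sym i≡j) d′)
  interpret σ (L[A] d) (l ∷ ls) rs =
    by I.L[A] l λ _ → interpret σ d (addˡ ls refl) (All.map there rs)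
  interpret {Γ = Γ} σ (R[A] {j = j} {i = i} {φ = φ} {Δ} j# d) ls (r ∷ rs)
    with fs , f ∷ gs ← All.++⁻ Γ (fresh-all (Γ ++ i ∶ ([A] φ) ∷ Δ) j#) =
    by I.R[A] r λ k → interpret (σ [ j ≔ k ]) d
      (All.map there (refresh _ˡ fs ls))
      (addʳ (refresh _ʳ gs rs)
        (cong₂ _∶_ (≡.sym (≔-hit σ j k)) (≡.sym (rename-fresh σ k φ (f ∘ there)))))
  interpret σ (sym d) ls (r ∷ rs) =
    infer I.sym (λ { (here refl) → r }) λ _ →
      interpret σ d (All.map there ls) (here refl ∷ All.map there rs)
  interpret σ ref+ ls (r ∷ rs) = infer I.ref+ (λ { (here refl) → r }) λ ()
  interpret σ ref- (l ∷ ls) rs = infer I.ref- (λ { (here refl) → l }) λ ()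
  interpret σ (no d e) ls rs =
    infer I.no (λ ())
      (pair (interpret σ d (All.map there ls) (here refl ∷ All.map there rs))
            (interpret σ e (All.map there ls) (here refl ∷ All.map there rs)))
  interpret σ (cc S≡) ls (r ∷ r′ ∷ rs) =
    infer (I.cc S≡) (λ { (here refl) → r ; (there (here refl)) → r′ }) λ ()

  -- From infinitary derivations back to finitary ones.

  bring : ∀ {a} → a ∈ Γ → ∃ λ Γ′ → a ∷ Γ′ ↭ Γ
  bring a∈Γ with xs , ys , refl ← ∈-∃++ a∈Γ = xs ++ ys , ↭-sym (shift _ xs ys)

  -- An infinitary rule finds its principal formula in the context, whereas the finitary rule adds a
  -- copy; this removes the copy.
  contractˡ : ∀ {a} → a ∈ Γ → S ⊢ a ∷ Γ ⇒ Δ → S ⊢ Γ ⇒ Δ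
  contractˡ {a = a} a∈Γ d with _ , p ← bring a∈Γ | i , φ , refl ← ∶-surjective a =
    exch p ↭-refl (Lc {i = i} {φ} (exch (prep _ (↭-sym p)) ↭-refl d))

  contractʳ : ∀ {a} → a ∈ Δ → S ⊢ Γ ⇒ a ∷ Δ → S ⊢ Γ ⇒ Δ
  contractʳ {a = a} a∈Δ d with _ , p ← bring a∈Δ | i , φ , refl ← ∶-surjective a =
    exch ↭-refl p (Rc {i = i} {φ} (exch ↭-refl (prep _ (↭-sym p)) d))

  Occurs : Context → Context → Signed → Set
  Occurs Γ Δ (a ˡ) = a ∈ Γ
  Occurs Γ Δ (a ʳ) = a ∈ Δ

  infix 4 _◁_⇒_

  _◁_⇒_ : Sequent → Context → Context → Set
  Σ ◁ Γ ⇒ Δ = ∀ {x} → x ∈ Σ → Occurs Γ Δ x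

  extendˡ : ∀ {a} → Σ ◁ Γ ⇒ Δ → (a ˡ ∷ Σ) ◁ a ∷ Γ ⇒ Δ
  extendˡ occ (here refl) = here refl
  extendˡ occ {_ ˡ} (there x∈) = there (occ x∈)
  extendˡ occ {_ ʳ} (there x∈) = occ x∈

  extendʳ : ∀ {a} → Σ ◁ Γ ⇒ Δ → (a ʳ ∷ Σ) ◁ Γ ⇒ a ∷ Δ
  extendʳ occ (here refl) = here refl
  extendʳ occ {_ ˡ} (there x∈) = occ x∈
  extendʳ occ {_ ʳ} (there x∈) = there (occ x∈)

  reflect : ⊩ Σ → Σ ◁ Γ ⇒ Δ → S ⊢ Γ ⇒ Δ
  reflect-logical : ∀ {I P x} → I.Logical {I} x P → x ∈ Σ → (∀ p → ⊩ P p ++ Σ) →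
                    Σ ◁ Γ ⇒ Δ → S ⊢ Γ ⇒ Δ

  reflect (infer (logical r) Π⊆ ds) occ = reflect-logical r (Π⊆ (here refl)) ds occ
  reflect (infer (I.init e) Π⊆ _) occ
    with _ , p ← bring (occ (Π⊆ (here refl)))
       | _ , q ← bring (occ (Π⊆ (there (here refl)))) = exch p q (init e)
  reflect (infer I.sym Π⊆ ds) occ =
    contractʳ (occ (Π⊆ (here refl))) (sym (reflect (ds tt) (extendʳ occ)))
  reflect (infer I.ref+ Π⊆ _) occ = contractʳ (occ (Π⊆ (here refl))) ref+
  reflect (infer I.ref- Π⊆ _) occ = contractˡ (occ (Π⊆ (here refl))) ref-
  reflect (infer I.no _ ds) occ =
    no (reflect (ds true) (extendʳ occ)) (reflect (ds false) (extendʳ occ))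
  reflect (infer (I.cc S≡) Π⊆ _) occ =
    -- The inner contraction removes the copy of `R⁺(i,j)`, looking past that of `R⁻(i,j)`, which
    -- the outer one removes.
    contractʳ (occ (Π⊆ (there (here refl))))
      (contractʳ (there (occ (Π⊆ (here refl)))) (cc S≡))

  reflect-logical I.L¬ x∈ ds occ =
    contractˡ (occ x∈) (L¬ (reflect (ds tt) (extendʳ occ)))
  reflect-logical I.R¬ x∈ ds occ =
    contractʳ (occ x∈) (R¬ (reflect (ds tt) (extendˡ occ)))
  reflect-logical I.L∨ x∈ ds occ =
    contractˡ (occ x∈) (L∨ (reflect (ds true) (extendˡ occ)) (reflect (ds false) (extendˡ occ)))
  reflect-logical I.R∨₁ x∈ ds occ =
    contractʳ (occ x∈) (R∨₁ (reflect (ds tt) (extendʳ occ)))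
  reflect-logical I.R∨₂ x∈ ds occ =
    contractʳ (occ x∈) (R∨₂ (reflect (ds tt) (extendʳ occ)))
  reflect-logical I.L∧₁ x∈ ds occ =
    contractˡ (occ x∈) (L∧₁ (reflect (ds tt) (extendˡ occ)))
  reflect-logical I.L∧₂ x∈ ds occ =
    contractˡ (occ x∈) (L∧₂ (reflect (ds tt) (extendˡ occ)))
  reflect-logical I.R∧ x∈ ds occ =
    contractʳ (occ x∈) (R∧ (reflect (ds true) (extendʳ occ)) (reflect (ds false) (extendʳ occ)))
  reflect-logical {Γ = Γ} {Δ = Δ} (I.L◇₁ {i = i} {s} {φ}) x∈ ds occ
    -- The rule is applied before the copy of the principal formula is contracted, so `j` has to
    -- avoid that copy as well as `Γ` and `Δ`.
    with j , j# ← fresh (concatMap nominalsᴸ (i ∶ ◇ s φ ∷ Γ ++ Δ)) =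
    contractˡ (occ x∈) (L◇₁ j# (reflect (ds j) (extendˡ occ)))
  reflect-logical {Γ = Γ} {Δ = Δ} (I.L◇₂ {i = i} {s} {φ}) x∈ ds occ
    with j , j# ← fresh (concatMap nominalsᴸ (i ∶ ◇ s φ ∷ Γ ++ Δ)) =
    contractˡ (occ x∈) (L◇₂ j# (reflect (ds j) (extendˡ occ)))
  reflect-logical (I.R◇ c) x∈ ds occ =
    contractʳ (occ x∈)
      (R◇ c (reflect (ds true) (extendʳ occ)) (reflect (ds false) (extendʳ occ)))
  reflect-logical I.L[A] x∈ ds occ =
    contractˡ (occ x∈) (L[A] (reflect (ds tt) (extendˡ occ)))
  reflect-logical {Γ = Γ} {Δ = Δ} (I.R[A] {i = i} {φ}) x∈ ds occ
    with j , j# ← fresh (concatMap nominalsᴸ (Γ ++ i ∶ ([A] φ) ∷ Δ)) =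
    contractʳ (occ x∈) (R[A] j# (reflect (ds j) (extendʳ occ)))

  -- Transfer of cut to the finitary systems.

  cut-admissible : CutAdmissible S
  cut-admissible {Γ} {Δ} {i} {φ} d e =
    reflect (cut i φ (interpret id d (All.map there ls) (principal _ʳ ∷ All.map there rs))
                     (interpret id e (principal _ˡ ∷ All.map there ls) (All.map there rs)))
            occ
    where
    Σ₀ : Sequent
    Σ₀ = map _ˡ Γ ++ map _ʳ Δ

    -- Renaming by `id` is the identity only up to a proof by cases on formulas, hence the transport
    -- here and in `ls` and `rs`.
    principal : (sign : LFormula → Signed) → sign (renameᴸ id (i ∶ φ)) ∈ sign (i ∶ φ) ∷ Σ₀
    principal sign = here (cong sign (renameᴸ-id (i ∶ φ)))

    ls : Lefts id Γ Σ₀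
    ls = All.tabulate λ {a} a∈ →
      subst (λ b → b ˡ ∈ Σ₀) (≡.sym (renameᴸ-id a)) (∈-++⁺ˡ (∈-map⁺ _ˡ a∈))

    rs : Rights id Δ Σ₀
    rs = All.tabulate λ {a} a∈ →
      subst (λ b → b ʳ ∈ Σ₀) (≡.sym (renameᴸ-id a)) (∈-++⁺ʳ (map _ˡ Γ) (∈-map⁺ _ʳ a∈))

    occ : Σ₀ ◁ Γ ⇒ Δ
    occ x∈ = All.lookup {P = Occurs Γ Δ}
      (All.++⁺ (All.map⁺ {xs = Γ} (All.tabulate id)) (All.map⁺ {xs = Δ} (All.tabulate id))) x∈

theorem4 : (At N : Set) → At ↣ ℕ → N ↔ ℕ →
    let open PNL At N in CutAdmissible DS × CutAdmissible DSᶜᶜ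
theorem4 At N _ N↔ℕ =
  Translation.cut-admissible At N N↔ℕ DS , Translation.cut-admissible At N N↔ℕ DSᶜᶜ
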